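{- Let $n$ be a positive integer, let $G$ be the complete bipartite graph $K_{n,n}$, and let $\mathcal{M}_S$ be a family of at most $3n/4$ perfect matchings of $G$ (different matchings in the family may share edges). Then there is a perfect matching of $G$ that is light and rainbow with respect to $\mathcal{M}_S$ and which contains a maximum sized $0$-light matching of $G$.
   Context: Each member of the family $\mathcal{M}_S$ is thought of as a colour: an edge of $G$ has as its colours the members of $\mathcal{M}_S$ containing it. A matching $M$ of $G$ is $k$-light with respect to $\mathcal{M}_S$ if no edge of $M$ lies in more than $k$ members of $\mathcal{M}_S$ (so $0$-light means every edge of $M$ lies in no member of $\mathcal{M}_S$), and $k$-rainbow if no member of $\mathcal{M}_S$ contains more than $k$ edges of $M$. Light means $1$-light and rainbow means $1$-rainbow. A maximum sized $0$-light matching is a $0$-light matching of $G$ of largest possible cardinality. -}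

module Defs where

open import Data.Nat using (ℕ; zero; suc; _≤_; _+_)
open import Data.Fin using (Fin; zero; suc)
open import Data.Fin.Permutation using (Permutation′; _⟨$⟩ʳ_)
open import Data.Product using (_×_; _,_; proj₁; proj₂; Σ)
open import Data.Sum using (_⊎_)
open import Data.List using (List; length)
open import Data.List.Membership.Propositional using (_∈_)
open import Data.List.Relation.Unary.Unique.Propositional using (Unique)
open import Relation.Nullary using (¬_; Dec; yes; no)
open import Relation.Binary.PropositionalEquality using (_≡_; _≢_)
open import Data.Fin using (_≟_)

-- The complete bipartite graph K_{n,n}: left vertices Fin n, right vertices Fin n;
-- every pair (i , j) is an edge.
Edge : ℕ → Set
Edge n = Fin n × Fin n

PerfectMatching : ℕ → Set
PerfectMatching n = Permutation′ n

_∈PM_ : ∀ {n} → Edge n → PerfectMatching n → Set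
(i , j) ∈PM π = π ⟨$⟩ʳ i ≡ j

count : ∀ {m} {P : Fin m → Set} → ((k : Fin m) → Dec (P k)) → ℕ
count {zero} d = 0
count {suc m} d with d zero
... | yes _ = suc (count (λ k → d (suc k)))
... | no _ = count (λ k → d (suc k))

-- A family of m perfect matchings, given as an indexed family of pairwise
-- distinct perfect matchings (a set of matchings).
Family : ℕ → ℕ → Set
Family m n = Fin m → PerfectMatching n

Distinct : ∀ {m n} → Family m n → Set
Distinct {m} {n} F = (k l : Fin m) → k ≢ l → ¬ ((i : Fin n) → F k ⟨$⟩ʳ i ≡ F l ⟨$⟩ʳ i)

colours : ∀ {m n} → Family m n → Edge n → ℕ
colours F (i , j) = count (λ k → F k ⟨$⟩ʳ i ≟ j)

sharedEdges : ∀ {m n} → Family m n → PerfectMatching n → Fin m → ℕ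
sharedEdges F π k = count (λ i → F k ⟨$⟩ʳ i ≟ π ⟨$⟩ʳ i)

IsMatching : ∀ {n} → List (Edge n) → Set
IsMatching M = Unique M × (∀ {e f} → e ∈ M → f ∈ M →
  (proj₁ e ≡ proj₁ f ⊎ proj₂ e ≡ proj₂ f) → e ≡ f)

KLight : ∀ {m n} → ℕ → Family m n → List (Edge n) → Set
KLight k F M = ∀ {e} → e ∈ M → colours F e ≤ k

KLightPM : ∀ {m n} → ℕ → Family m n → PerfectMatching n → Set
KLightPM {n = n} k F π = (i : Fin n) → colours F (i , π ⟨$⟩ʳ i) ≤ k

KRainbowPM : ∀ {m n} → ℕ → Family m n → PerfectMatching n → Set
KRainbowPM {m} k F π = (l : Fin m) → sharedEdges F π l ≤ k

IsMax0Light : ∀ {m n} → Family m n → List (Edge n) → Set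
IsMax0Light {n = n} F M = IsMatching M × KLight 0 F M ×
  (∀ (M′ : List (Edge n)) → IsMatching M′ → KLight 0 F M′ → length M′ ≤ length M)

{-# OPTIONS --safe #-}
module Submission where

-- Choose a perfect matching p with as many 0-light edges as possible and, subject to that, a largest
-- set R of rows whose p-edges have one colour each, all of them different. By maximality of the
-- number of 0-light edges these contain a maximum 0-light matching, so it remains to exclude a row x
-- outside R whose edge (x , p x) is not 0-light.
-- Call an edge new if it has exactly one colour and this does not occur on R, and let d and d̄ count the
-- 0-light edges in row x and in column p x. Exchanging the ends of two edges of p never improves the
-- choice, which confines the new edges of row x to few columns; counting colours along the row and
-- along the column shows that at least 2n + 2 - 2m - |R| ≥ 3 rows f of R have both (x , p f) and
-- (f , p x) new. These two edges share their colour, since otherwise they could replace (f , p f).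
-- For each of the d̄ rows w with (w , p x) 0-light, exchanging x and w yields another optimal choice,
-- in which x is matched to p w, so this also holds with p w for p x. A row f occurs for at most one w,
-- as the colour of (x , p f) determines w. Hence 3 d̄ ≤ |R|, which is incompatible with 4m ≤ 3n.

open import Defs
open import Data.Bool using (Bool; true; false)
import Data.Bool.Properties as Bool
open import Data.Empty using (⊥; ⊥-elim)
open import Data.Fin using (Fin; zero; suc; _≟_)
open import Data.Fin.Permutation
  using (_⟨$⟩ʳ_; _⟨$⟩ˡ_; inverseˡ; inverseʳ; permutation; transpose; _∘ₚ_) renaming (id to idₚ)
import Data.Fin.Permutation.Components as PC
open import Data.Fin.Properties using (any?; all?; suc-injective; 0≢1+n)
open import Data.List using (List; []; _∷_; length; map; filter; tabulate; allFin)
open import Data.List.Membership.Propositional using (_∈_)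
open import Data.List.Membership.Propositional.Properties using (∈-map⁻; ∈-filter⁻)
open import Data.List.Properties using (length-map)
open import Data.List.Relation.Unary.All as All using ()
open import Data.List.Relation.Unary.AllPairs using (_∷_)
open import Data.List.Relation.Unary.Any using (here; there)
open import Data.List.Relation.Unary.Unique.Propositional using (Unique)
open import Data.List.Relation.Unary.Unique.Propositional.Properties using (map⁺; filter⁺; allFin⁺)
open import Data.Nat using (ℕ; zero; suc; _+_; _*_; _≤_; z≤n; s≤s; _≤?_)
import Data.Nat as ℕ
open import Data.Nat.Properties hiding (_≟_; _≤?_; suc-injective; 0≢1+n)
open import Data.Nat.Tactic.RingSolver using (solve-∀)
open import Data.Product using (Σ; ∃; _×_; _,_; proj₁; proj₂)
open import Data.Sum using (_⊎_; inj₁; inj₂)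
open import Function using (_∘_; id)
open import Relation.Binary.PropositionalEquality
open import Relation.Nullary using (¬_; Dec; yes; no; ¬?)
open import Relation.Nullary.Decidable using (map′; _×-dec_; _→-dec_)
open import Algebra.Properties.CommutativeMonoid.Sum +-0-commutativeMonoid
  using (sum; ∑-distrib-+; ∑-comm; sum-permute; sum-cong-≗)

private
  variable
    m n : ℕ
    A B : Set

-- Indicators and finite sums.

⟦_⟧ : Dec A → ℕ
⟦ yes _ ⟧ = 1
⟦ no _ ⟧ = 0

⟦⟧-yes : (d : Dec A) → A → ⟦ d ⟧ ≡ 1
⟦⟧-yes (yes _) _ = refl
⟦⟧-yes (no ¬a) a = ⊥-elim (¬a a)

⟦⟧-no : (d : Dec A) → ¬ A → ⟦ d ⟧ ≡ 0
⟦⟧-no (yes a) ¬a = ⊥-elim (¬a a)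
⟦⟧-no (no _) _ = refl

⟦⟧-≤1 : (d : Dec A) → ⟦ d ⟧ ≤ 1
⟦⟧-≤1 (yes _) = ≤-refl
⟦⟧-≤1 (no _) = z≤n

⟦⟧-mono : (d : Dec A) (e : Dec B) → (A → B) → ⟦ d ⟧ ≤ ⟦ e ⟧
⟦⟧-mono (no _) e f = z≤n
⟦⟧-mono (yes a) e f = ≤-reflexive (sym (⟦⟧-yes e (f a)))

⟦⟧-cong : (d : Dec A) (e : Dec B) → (A → B) → (B → A) → ⟦ d ⟧ ≡ ⟦ e ⟧
⟦⟧-cong d e f g = ≤-antisym (⟦⟧-mono d e f) (⟦⟧-mono e d g)

-- Nested uses bound the total of mutually exclusive conditions; a variable `t` admits bounds other
-- than 1.
⟦⟧-exclusive : (d : Dec A) {s t : ℕ} → s ≤ t → 1 ≤ t → (A → s ≡ 0) → ⟦ d ⟧ + s ≤ t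
⟦⟧-exclusive (no _) s≤t _ _ = s≤t
⟦⟧-exclusive (yes a) {s} _ 1≤t f rewrite f a = 1≤t

sum-mono : {f g : Fin n → ℕ} → (∀ i → f i ≤ g i) → sum f ≤ sum g
sum-mono {zero} le = z≤n
sum-mono {suc n} le = +-mono-≤ (le zero) (sum-mono (le ∘ suc))

sum-const : ∀ n k → sum {n} (λ _ → k) ≡ n * k
sum-const zero k = refl
sum-const (suc n) k = cong (k +_) (sum-const n k)

sum-const-1 : ∀ n → sum {n} (λ _ → 1) ≡ n
sum-const-1 n = trans (sum-const n 1) (*-identityʳ n)

sum-*ˡ : ∀ k (f : Fin n → ℕ) → sum (λ i → k * f i) ≡ k * sum f
sum-*ˡ {zero} k f = sym (*-zeroʳ k)
sum-*ˡ {suc n} k f = trans (cong (k * f zero +_) (sum-*ˡ k (f ∘ suc))) (sym (*-distribˡ-+ k (f zero) _))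

term≤sum : (f : Fin n → ℕ) (i : Fin n) → f i ≤ sum f
term≤sum f zero = m≤m+n _ _
term≤sum f (suc i) = ≤-trans (term≤sum (f ∘ suc) i) (m≤n+m _ _)

sum-δ : (i : Fin n) (k : ℕ) → sum (λ j → ⟦ j ≟ i ⟧ * k) ≡ k
sum-δ {suc n} zero k = begin
  k + 0 + sum {n} (λ _ → 0) ≡⟨ cong (k + 0 +_) (trans (sum-const n 0) (*-zeroʳ n)) ⟩
  k + 0 + 0 ≡⟨ trans (+-identityʳ _) (+-identityʳ k) ⟩
  k ∎
  where open ≡-Reasoning
sum-δ {suc n} (suc i) k =
  trans (sum-cong-≗ λ j → cong (_* k) (⟦⟧-cong (suc j ≟ suc i) (j ≟ i) suc-injective (cong suc))) (sum-δ i k)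

sum-δ-1 : (i : Fin n) → sum (λ j → ⟦ j ≟ i ⟧) ≡ 1
sum-δ-1 {n} i = trans (sum-cong-≗ {n} (λ j → sym (*-identityʳ _))) (sum-δ i 1)

sum-≤1 : {P : Fin n → Set} (P? : ∀ i → Dec (P i)) → (∀ i j → P i → P j → i ≡ j) → sum (λ i → ⟦ P? i ⟧) ≤ 1
sum-≤1 {zero} P? unique = z≤n
sum-≤1 {suc n} P? unique with P? zero
... | no _ = sum-≤1 (P? ∘ suc) λ i j p q → suc-injective (unique (suc i) (suc j) p q)
... | yes p = s≤s (≤-reflexive (trans (sum-cong-≗ λ i → ⟦⟧-no (P? (suc i)) λ q → 0≢1+n (unique zero (suc i) p q))
                                     (trans (sum-const n 0) (*-zeroʳ n))))

-- Different witnesses `i` and `j` would put the indicators of both points, with total 2, below that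
-- of `P`.
sum-≤1⇒unique : {P : Fin n → Set} (P? : ∀ i → Dec (P i)) → sum (λ i → ⟦ P? i ⟧) ≤ 1 →
                ∀ {i j} → P i → P j → i ≡ j
sum-≤1⇒unique P? le {i} {j} p q with i ≟ j
... | yes i≡j = i≡j
... | no i≢j = ⊥-elim (<⇒≱ two le)
  where
  pointwise : ∀ k → ⟦ k ≟ i ⟧ + ⟦ k ≟ j ⟧ ≤ ⟦ P? k ⟧
  pointwise k with k ≟ i | k ≟ j
  ... | yes refl | yes refl = ⊥-elim (i≢j refl)
  ... | yes refl | no _ = ≤-reflexive (sym (⟦⟧-yes (P? k) p))
  ... | no _ | yes refl = ≤-reflexive (sym (⟦⟧-yes (P? k) q))
  ... | no _ | no _ = z≤n
  two : 2 ≤ sum (λ k → ⟦ P? k ⟧)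
  two = subst (_≤ _) (trans (∑-distrib-+ (λ k → ⟦ k ≟ i ⟧) (λ k → ⟦ k ≟ j ⟧)) (cong₂ _+_ (sum-δ-1 i) (sum-δ-1 j)))
          (sum-mono pointwise)

count≡sum : {P : Fin n → Set} (P? : ∀ i → Dec (P i)) → count P? ≡ sum (λ i → ⟦ P? i ⟧)
count≡sum {zero} P? = refl
count≡sum {suc n} P? with P? zero
... | yes _ = cong suc (count≡sum (P? ∘ suc))
... | no _ = count≡sum (P? ∘ suc)

length-filter-tabulate : {P : A → Set} (P? : ∀ a → Dec (P a)) (f : Fin n → A) →
                         length (filter P? (tabulate f)) ≡ sum (λ i → ⟦ P? (f i) ⟧)
length-filter-tabulate {n = zero} P? f = refl
length-filter-tabulate {n = suc n} P? f with P? (f zero)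
... | yes _ = cong suc (length-filter-tabulate P? (f ∘ suc))
... | no _ = length-filter-tabulate P? (f ∘ suc)

-- In the induction the key of the head is removed from `P`, which frees one unit for the head; no
-- later member needs that key.
length≤sum : (key : A → Fin n) {P : Fin n → Set} (P? : ∀ i → Dec (P i)) (xs : List A) → Unique xs →
             (∀ {x y} → x ∈ xs → y ∈ xs → key x ≡ key y → x ≡ y) → (∀ {x} → x ∈ xs → P (key x)) →
             length xs ≤ sum (λ i → ⟦ P? i ⟧)
length≤sum key P? [] _ _ _ = z≤n
length≤sum {n = n} key {P} P? (x ∷ xs) (x∉xs ∷ uniq) inj all =
  ≤-trans (s≤s (length≤sum key P′? xs uniq (λ p q → inj (there p) (there q)) all′)) step
  where
  P′? : (i : Fin n) → Dec (P i × i ≢ key x)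
  P′? i = P? i ×-dec ¬? (i ≟ key x)
  all′ : ∀ {y} → y ∈ xs → P (key y) × key y ≢ key x
  all′ y∈xs = all (there y∈xs) , λ eq → All.lookup x∉xs y∈xs (sym (inj (there y∈xs) (here refl) eq))
  pointwise : ∀ i → ⟦ i ≟ key x ⟧ + ⟦ P′? i ⟧ ≤ ⟦ P? i ⟧
  pointwise i with i ≟ key x | P? i
  ... | yes refl | yes _ = ≤-refl
  ... | yes refl | no ¬p = ⊥-elim (¬p (all (here refl)))
  ... | no _ | yes _ = ≤-refl
  ... | no _ | no _ = z≤n
  step : 1 + sum (λ i → ⟦ P′? i ⟧) ≤ sum (λ i → ⟦ P? i ⟧)
  step = subst (_≤ _) (trans (∑-distrib-+ (λ i → ⟦ i ≟ key x ⟧) (λ i → ⟦ P′? i ⟧)) (cong (_+ sum (λ i → ⟦ P′? i ⟧)) (sum-δ-1 (key x))))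
           (sum-mono pointwise)

-- The additive form avoids subtraction: once each sum is given the values of the other function at
-- `i` and `j`, the two agree term by term.
sum-change₂ : (f g : Fin n → ℕ) {i j : Fin n} → i ≢ j → (∀ k → k ≢ i → k ≢ j → f k ≡ g k) →
              sum f + (g i + g j) ≡ sum g + (f i + f j)
sum-change₂ f g {i} {j} i≢j same = begin
  sum f + (g i + g j)
    ≡⟨ expand f (g i) (g j) ⟨
  sum (λ k → f k + (⟦ k ≟ i ⟧ * g i + ⟦ k ≟ j ⟧ * g j))
    ≡⟨ sum-cong-≗ pointwise ⟩
  sum (λ k → g k + (⟦ k ≟ i ⟧ * f i + ⟦ k ≟ j ⟧ * f j))
    ≡⟨ expand g (f i) (f j) ⟩
  sum g + (f i + f j) ∎
  where
  open ≡-Reasoning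
  expand : ∀ h a b → sum (λ k → h k + (⟦ k ≟ i ⟧ * a + ⟦ k ≟ j ⟧ * b)) ≡ sum h + (a + b)
  expand h a b = trans (∑-distrib-+ h _)
    (cong (sum h +_) (trans (∑-distrib-+ (λ k → ⟦ k ≟ i ⟧ * a) _) (cong₂ _+_ (sum-δ i a) (sum-δ j b))))
  swap-+ : ∀ a b → a + (1 * b + 0) ≡ b + (1 * a + 0)
  swap-+ = solve-∀
  swap-+0 : ∀ a b → a + (b + 0) ≡ b + (a + 0)
  swap-+0 = solve-∀
  pointwise : ∀ k → f k + (⟦ k ≟ i ⟧ * g i + ⟦ k ≟ j ⟧ * g j) ≡ g k + (⟦ k ≟ i ⟧ * f i + ⟦ k ≟ j ⟧ * f j)
  pointwise k with k ≟ i | k ≟ j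
  ... | yes refl | yes refl = ⊥-elim (i≢j refl)
  ... | yes refl | no _ = swap-+ (f k) (g k)
  ... | no _ | yes refl = swap-+0 (f k) (g k)
  ... | no k≢i | no k≢j = cong (_+ 0) (same k k≢i k≢j)

-- Transpositions.

transpose-matchˡ : (i j : Fin n) → PC.transpose i j i ≡ j
transpose-matchˡ i j with i ≟ i
... | yes _ = refl
... | no i≢i = ⊥-elim (i≢i refl)

transpose-matchʳ : (i j : Fin n) → PC.transpose i j j ≡ i
transpose-matchʳ i j with j ≟ i
... | yes j≡i = j≡i
... | no _ with j ≟ j
...   | yes _ = refl
...   | no j≢j = ⊥-elim (j≢j refl)

transpose-mismatch : {i j k : Fin n} → k ≢ i → k ≢ j → PC.transpose i j k ≡ k
transpose-mismatch {i = i} {j} {k} k≢i k≢j with k ≟ i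
... | yes k≡i = ⊥-elim (k≢i k≡i)
... | no _ with k ≟ j
...   | yes k≡j = ⊥-elim (k≢j k≡j)
...   | no _ = refl

-- Exhaustive search and greatest values.

Searchable : Set → Set₁
Searchable A = (P : A → Set) → (∀ a → Dec (P a)) → Dec (∃ P)

search-Fin : Searchable (Fin n)
search-Fin P P? = any? P?

search-Bool : Searchable Bool
search-Bool P P? with P? true | P? false
... | yes p | _ = yes (true , p)
... | no _ | yes p = yes (false , p)
... | no ¬p | no ¬q = no λ { (true , p) → ¬p p ; (false , q) → ¬q q }

search-× : Searchable A → Searchable B → Searchable (A × B)
search-× sA sB P P? = map′ (λ (a , b , p) → (a , b) , p) (λ ((a , b) , p) → a , b , p)
  (sA _ λ a → sB _ λ b → P? (a , b))

cons : A → (Fin n → A) → Fin (suc n) → A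
cons a f zero = a
cons a f (suc i) = f i

-- A function is only pointwise equal to the `cons` of its first value and its rest, hence the
-- assumption that `P` respects `_≗_`.
search-→ : Searchable A → (P : (Fin n → A) → Set) → (∀ {f g} → f ≗ g → P f → P g) →
           (∀ f → Dec (P f)) → Dec (∃ P)
search-→ {n = zero} sA P resp P? =
  map′ (λ p → _ , p) (λ (f , p) → resp (λ ()) p) (P? λ ())
search-→ {n = suc n} sA P resp P? =
  map′ (λ (a , f , p) → cons a f , p)
       (λ (f , p) → f zero , f ∘ suc , resp (λ { zero → refl ; (suc i) → refl }) p)
       (sA _ λ a → search-→ sA (P ∘ cons a) (λ eq → resp λ { zero → refl ; (suc i) → eq i }) (P? ∘ cons a))

maximum : (Q : ℕ → Set) → (∀ k → Dec (Q k)) → Q 0 → (b : ℕ) → (∀ {k} → Q k → k ≤ b) →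
          ∃ λ k → Q k × (∀ {l} → Q l → l ≤ k)
maximum Q Q? q₀ zero bound = 0 , q₀ , bound
maximum Q Q? q₀ (suc b) bound with Q? (suc b)
... | yes q = suc b , q , bound
... | no ¬q = maximum Q Q? q₀ b λ {k} qk → ≤-pred (≤∧≢⇒< (bound qk) λ { refl → ¬q qk })

sum-+-≤ : {f g h : Fin n → ℕ} → (∀ i → f i + g i ≤ h i) → sum f + sum g ≤ sum h
sum-+-≤ {f = f} {g} le = ≤-trans (≤-reflexive (sym (∑-distrib-+ f g))) (sum-mono le)

-- Linear inequalities between the counts.

infixr 5 _⊕≤_
_⊕≤_ : ∀ {a b c d} → a ≤ b → c ≤ d → a + c ≤ b + d
_⊕≤_ = +-mono-≤

-- Linear arithmetic by certificate: `c ≤ d` is a weighted sum of the hypotheses, and `k` collects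
-- what its two sides have in common.
cancel : ∀ k {a b c d} → c ≤ d → c ≡ a + k → d ≡ b + k → a ≤ b
cancel k {a} {b} le refl refl = +-cancelʳ-≤ k a b le

-- `d` and `e` stand for the 0-light edges in a line and in the crossing one, `o` for the edges with
-- a colour from `R`, `l` for the new edges, `p` for the new edges at indices in `R`.
new-in-matched-lines : ∀ n m r d e o l p → n * 2 ≤ m + (2 * d + (o + l)) → o ≤ r →
                       l + (1 + (r + (d + e))) ≤ n + p → n + 1 + e ≤ m + d + p
new-in-matched-lines n m r d e o l p h₁ h₂ h₃ =
  cancel (n + r + d + l + o) (h₁ ⊕≤ h₂ ⊕≤ h₃) (lhs n e d l o r) (rhs m r d l o n p)
  where
  lhs : ∀ n e d l o r → n * 2 + (o + (l + (1 + (r + (d + e))))) ≡ n + 1 + e + (n + r + d + l + o)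
  lhs = solve-∀
  rhs : ∀ m r d l o n p → m + (2 * d + (o + l)) + (r + (n + p)) ≡ m + d + p + (n + r + d + l + o)
  rhs = solve-∀

-- `p` and `q` count the indices in `R` with a new edge in the row and in the column, `v` those with
-- both. The first three hypotheses give `v + r ≥ 2n + 2 - 2m`, the next three `r ≤ 2m - n - 1`, so
-- `v ≥ 3n + 3 - 4m`.
three-overlaps : ∀ n m r d e p q v → n + 1 + e ≤ m + d + p → n + 1 + d ≤ m + e + q → p + q ≤ r + v →
                 1 + (r + (d + e)) ≤ n → n ≤ m + d → n ≤ m + e → 4 * m ≤ 3 * n → 3 ≤ v
three-overlaps n m r d e p q v h₁ h₂ h₃ h₄ h₅ h₆ h₇ =
  cancel (4 * n + 4 * m + 2 * d + 2 * e + p + q + r) (h₁ ⊕≤ h₂ ⊕≤ h₃ ⊕≤ h₄ ⊕≤ h₅ ⊕≤ h₆ ⊕≤ h₇)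
    (lhs n m r d e p q) (rhs n m r d e p q v)
  where
  lhs : ∀ n m r d e p q → n + 1 + e + (n + 1 + d + (p + q + (1 + (r + (d + e)) + (n + (n + 4 * m)))))
        ≡ 3 + (4 * n + 4 * m + 2 * d + 2 * e + p + q + r)
  lhs = solve-∀
  rhs : ∀ n m r d e p q v → m + d + p + (m + e + q + (r + v + (n + (m + d + (m + e + 3 * n)))))
        ≡ v + (4 * n + 4 * m + 2 * d + 2 * e + p + q + r)
  rhs = solve-∀

-- From `3e ≤ r ≤ n - 1 - d - e` and `d, e ≥ n - m` follows `4n + 1 ≤ 5m`. The weights 4 and 5 make
-- this comparable with `4m ≤ 3n`.
too-many-overlaps : ∀ n m r d e → 3 * e ≤ r → 1 + (r + (d + e)) ≤ n → n ≤ m + d → n ≤ m + e →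
                    4 * m ≤ 3 * n → ⊥
too-many-overlaps n m r d e h₁ h₂ h₃ h₄ h₅ =
  4+n≰0 (cancel (19 * n + 20 * m + 4 * r + 4 * d + 16 * e)
    (*-monoʳ-≤ 4 (h₁ ⊕≤ h₂ ⊕≤ h₃ ⊕≤ *-monoʳ-≤ 4 h₄) ⊕≤ *-monoʳ-≤ 5 h₅) (lhs n m r d e) (rhs n m r d e))
  where
  4+n≰0 : ¬ (4 + n ≤ 0)
  4+n≰0 ()
  lhs : ∀ n m r d e → 4 * (3 * e + (1 + (r + (d + e)) + (n + 4 * n))) + 5 * (4 * m)
        ≡ 4 + n + (19 * n + 20 * m + 4 * r + 4 * d + 16 * e)
  lhs = solve-∀
  rhs : ∀ n m r d e → 4 * (r + (n + (m + d + 4 * (m + e)))) + 5 * (3 * n)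
        ≡ 0 + (19 * n + 20 * m + 4 * r + 4 * d + 16 * e)
  rhs = solve-∀

-- Colours of edges and their total along a line.

module _ {m n : ℕ} (F : Family m n) where

  Has : Fin m → Edge n → Set
  Has l (i , j) = F l ⟨$⟩ʳ i ≡ j

  Has? : ∀ l e → Dec (Has l e)
  Has? l (i , j) = F l ⟨$⟩ʳ i ≟ j

  colours≡sum : ∀ e → colours F e ≡ sum (λ l → ⟦ Has? l e ⟧)
  colours≡sum e = count≡sum (λ l → Has? l e)

  has⇒colours>0 : ∀ {l e} → Has l e → 1 ≤ colours F e
  has⇒colours>0 {l} {e} h = begin
    1 ≡⟨ ⟦⟧-yes (Has? l e) h ⟨
    ⟦ Has? l e ⟧ ≤⟨ term≤sum _ l ⟩
    sum (λ l → ⟦ Has? l e ⟧) ≡⟨ colours≡sum e ⟨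
    colours F e ∎
    where open ≤-Reasoning

  colour-unique : ∀ {k l e} → colours F e ≡ 1 → Has k e → Has l e → k ≡ l
  colour-unique {e = e} one =
    sum-≤1⇒unique (λ l → Has? l e) (≤-reflexive (trans (sym (colours≡sum e)) one))

  -- Each of the `m` matchings meets a column in exactly one edge.
  colours-column : ∀ j → sum (λ i → colours F (i , j)) ≡ m
  colours-column j = begin
    sum (λ i → colours F (i , j)) ≡⟨ sum-cong-≗ {n} (λ i → colours≡sum (i , j)) ⟩
    sum (λ i → sum λ l → ⟦ F l ⟨$⟩ʳ i ≟ j ⟧) ≡⟨ ∑-comm (λ i l → ⟦ F l ⟨$⟩ʳ i ≟ j ⟧) ⟩
    sum (λ l → sum λ i → ⟦ F l ⟨$⟩ʳ i ≟ j ⟧) ≡⟨ sum-cong-≗ {m} (λ l → sym (sum-permute (λ i → ⟦ i ≟ j ⟧) (F l))) ⟩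
    sum {m} (λ l → sum λ i → ⟦ i ≟ j ⟧) ≡⟨ sum-cong-≗ {m} (λ _ → sum-δ-1 j) ⟩
    sum {m} (λ l → 1) ≡⟨ sum-const-1 m ⟩
    m ∎
    where open ≡-Reasoning

  -- The columns are listed through `π`, so that one index can denote a row and its partner column.
  colours-row : ∀ i (π : PerfectMatching n) → sum (λ j → colours F (i , π ⟨$⟩ʳ j)) ≡ m
  colours-row i π = begin
    sum (λ j → colours F (i , π ⟨$⟩ʳ j)) ≡⟨ sum-permute (λ j → colours F (i , j)) π ⟨
    sum (λ j → colours F (i , j)) ≡⟨ sum-cong-≗ {n} (λ j → colours≡sum (i , j)) ⟩
    sum (λ j → sum λ l → ⟦ F l ⟨$⟩ʳ i ≟ j ⟧) ≡⟨ ∑-comm (λ j l → ⟦ F l ⟨$⟩ʳ i ≟ j ⟧) ⟩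
    sum (λ l → sum λ j → ⟦ F l ⟨$⟩ʳ i ≟ j ⟧) ≡⟨ sum-cong-≗ {m} (λ l → trans
      (sum-cong-≗ {n} λ j → ⟦⟧-cong (F l ⟨$⟩ʳ i ≟ j) (j ≟ F l ⟨$⟩ʳ i) sym sym) (sum-δ-1 (F l ⟨$⟩ʳ i))) ⟩
    sum {m} (λ l → 1) ≡⟨ sum-const-1 m ⟩
    m ∎
    where open ≡-Reasoning

  -- Sets of differently coloured rows, and new edges.

  Zero? : ∀ e → Dec (colours F e ≡ 0)
  Zero? e = colours F e ℕ.≟ 0

  zeros : (Fin n → Fin n) → ℕ
  zeros p = sum (λ i → ⟦ Zero? (i , p i) ⟧)

  size : (Fin n → Bool) → ℕ
  size R = sum (λ i → ⟦ R i Bool.≟ true ⟧)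

  -- e has a colour in common with the edge of p at the row f of R
  Old : (Fin n → Fin n) → (Fin n → Bool) → Edge n → Fin n → Set
  Old p R e f = R f ≡ true × ∃ λ l → Has l e × Has l (f , p f)

  Old? : ∀ p R e f → Dec (Old p R e f)
  Old? p R e f = (R f Bool.≟ true) ×-dec any? λ l → Has? l e ×-dec Has? l (f , p f)

  New : (Fin n → Fin n) → (Fin n → Bool) → Edge n → Set
  New p R e = colours F e ≡ 1 × (∀ f → ¬ Old p R e f)

  New? : ∀ p R e → Dec (New p R e)
  New? p R e = (colours F e ℕ.≟ 1) ×-dec all? λ f → ¬? (Old? p R e f)

  Valid : (Fin n → Fin n) → (Fin n → Bool) → Set
  Valid p R = ∀ f → R f ≡ true → colours F (f , p f) ≡ 1 ×
    (∀ g → R g ≡ true → ∀ l → Has l (f , p f) → Has l (g , p g) → f ≡ g)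

  Valid? : ∀ p R → Dec (Valid p R)
  Valid? p R = all? λ f → (R f Bool.≟ true) →-dec (colours F (f , p f) ℕ.≟ 1) ×-dec
    all? λ g → (R g Bool.≟ true) →-dec all? λ l → Has? l (f , p f) →-dec Has? l (g , p g) →-dec (f ≟ g)

  Agree : (R : Fin n → Bool) (p q : Fin n → Fin n) → Set
  Agree R p q = ∀ f → R f ≡ true → p f ≡ q f

  -- The matching enters only through its edges at `R`, so an exchange between rows outside `R`
  -- keeps new edges new.
  New-agree : ∀ {R p q} → Agree R p q → ∀ {e} → New p R e → New q R e
  New-agree p≗q (one , new) = one , λ { f (Rf , l , h , h′) → new f (Rf , l , h , trans h′ (sym (p≗q f Rf))) }

  Valid-agree : ∀ {R p q} → Agree R p q → Valid p R → Valid q R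
  Valid-agree p≗q v f Rf rewrite sym (p≗q f Rf) =
    proj₁ (v f Rf) , λ g Rg l h h′ → proj₂ (v f Rf) g Rg l h (trans h′ (sym (p≗q g Rg)))

  insert : Fin n → (Fin n → Bool) → Fin n → Bool
  insert x R k with k ≟ x
  ... | yes _ = true
  ... | no _ = R k

  insert⁻ : ∀ {x R k} → insert x R k ≡ true → k ≡ x ⊎ R k ≡ true
  insert⁻ {x} {R} {k} eq with k ≟ x
  ... | yes k≡x = inj₁ k≡x
  ... | no _ = inj₂ eq

  size-insert : ∀ {x R} → R x ≡ false → 1 + size R ≤ size (insert x R)
  size-insert {x} {R} Rx = subst (λ k → k + size R ≤ size (insert x R)) (sum-δ-1 x) (sum-+-≤ pointwise)
    where
    pointwise : ∀ i → ⟦ i ≟ x ⟧ + ⟦ R i Bool.≟ true ⟧ ≤ ⟦ insert x R i Bool.≟ true ⟧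
    pointwise i with i ≟ x
    ... | yes refl rewrite Rx = ≤-refl
    ... | no _ = ≤-refl

  -- A new edge has a single colour, absent from `R`, so it clashes with no row there. This is
  -- played against the maximality of `R`.
  Valid-insert : ∀ {x R p} → Valid p R → New p R (x , p x) → Valid p (insert x R)
  Valid-insert {x} {R} {p} v (one , new) f Rf with insert⁻ {x} {R} {f} Rf
  ... | inj₁ refl = one , λ g Rg l h h′ → new⁻ g (insert⁻ {x} {R} {g} Rg) l h h′
    where
    new⁻ : ∀ g → g ≡ f ⊎ R g ≡ true → ∀ l → Has l (f , p f) → Has l (g , p g) → f ≡ g
    new⁻ g (inj₁ refl) l h h′ = refl
    new⁻ g (inj₂ Rg) l h h′ = ⊥-elim (new g (Rg , l , h , h′))
  ... | inj₂ Rf = proj₁ (v f Rf) , λ g Rg l h h′ → new⁻ g (insert⁻ {x} {R} {g} Rg) l h h′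
    where
    new⁻ : ∀ g → g ≡ x ⊎ R g ≡ true → ∀ l → Has l (f , p f) → Has l (g , p g) → f ≡ g
    new⁻ g (inj₁ refl) l h h′ = ⊥-elim (new f (Rf , l , h′ , h))
    new⁻ g (inj₂ Rg) l h h′ = proj₂ (v f Rf) g Rg l h h′

  -- Counting along one line.

  -- A row of `R` has a single colour, and by the injectivity hypothesis this lies on at most one of
  -- the edges `e j`; so each row of `R` accounts for at most one index.
  old-colours : ∀ {p R} → Valid p R → (e : Fin n → Edge n) → (∀ {l i j} → Has l (e i) → Has l (e j) → i ≡ j) →
                sum (λ j → ⟦ any? (Old? p R (e j)) ⟧) ≤ size R
  old-colours {p} {R} v e e-inj = begin
    sum (λ j → ⟦ any? (Old? p R (e j)) ⟧) ≤⟨ sum-mono (λ j → some≤sum (Old? p R (e j))) ⟩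
    sum (λ j → sum λ f → ⟦ Old? p R (e j) f ⟧) ≡⟨ ∑-comm (λ j f → ⟦ Old? p R (e j) f ⟧) ⟩
    sum (λ f → sum λ j → ⟦ Old? p R (e j) f ⟧) ≤⟨ sum-mono at-most-one ⟩
    size R ∎
    where
    open ≤-Reasoning
    some≤sum : {P : Fin n → Set} (P? : ∀ i → Dec (P i)) → ⟦ any? P? ⟧ ≤ sum (λ i → ⟦ P? i ⟧)
    some≤sum P? with any? P?
    ... | no _ = z≤n
    ... | yes (i , q) = ≤-trans (≤-reflexive (sym (⟦⟧-yes (P? i) q))) (term≤sum _ i)
    at-most-one : ∀ f → sum (λ j → ⟦ Old? p R (e j) f ⟧) ≤ ⟦ R f Bool.≟ true ⟧
    at-most-one f = fromDec (R f Bool.≟ true)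
      where
      fromDec : (d : Dec (R f ≡ true)) → sum (λ j → ⟦ Old? p R (e j) f ⟧) ≤ ⟦ d ⟧
      fromDec (no ¬Rf) = ≤-reflexive (trans (sum-cong-≗ {n} λ j → ⟦⟧-no (Old? p R (e j) f) (¬Rf ∘ proj₁))
                                     (trans (sum-const n 0) (*-zeroʳ n)))
      fromDec (yes Rf) = sum-≤1 (λ j → Old? p R (e j) f) λ
        { i j (_ , k , h , hf) (_ , l , h′ , hf′) →
          e-inj h (subst (λ l → Has l (e j)) (colour-unique (proj₁ (v f Rf)) hf′ hf) h′) }

  -- With e the row of x and ē the column of p x, or conversely, so that both lines are counted at once.
  module Line (p : Fin n → Fin n) (R : Fin n → Bool) (v : Valid p R) (x : Fin n) (e ē : Fin n → Edge n)
    (e-total : sum (λ j → colours F (e j)) ≡ m)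
    (e-inj : ∀ {l i j} → Has l (e i) → Has l (e j) → i ≡ j)
    (R-e : ∀ {j} → R j ≡ true → colours F (e j) ≢ 0)
    (R-ē : ∀ {j} → R j ≡ true → colours F (ē j) ≢ 0)
    (x∉R : R x ≡ false)
    (x-e : colours F (e x) ≢ 0)
    (x-ē : colours F (ē x) ≢ 0)
    (e-ē : ∀ {j} → colours F (e j) ≡ 0 → colours F (ē j) ≢ 0)
    (x-new : ¬ New p R (e x))
    (ē-new : ∀ {j} → colours F (ē j) ≡ 0 → ¬ New p R (e j))
    where

    private
      R? : ∀ j → Dec (R j ≡ true)
      R? j = R j Bool.≟ true

      d d̄ : ℕ
      d = sum (λ j → ⟦ Zero? (e j) ⟧)
      d̄ = sum (λ j → ⟦ Zero? (ē j) ⟧)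

      -- The hypotheses of the module make these four conditions mutually exclusive.
      classes : Fin n → ℕ
      classes j = ⟦ j ≟ x ⟧ + (⟦ R? j ⟧ + (⟦ Zero? (e j) ⟧ + ⟦ Zero? (ē j) ⟧))

      sum-classes : sum classes ≡ 1 + (size R + (d + d̄))
      sum-classes =
        trans (∑-distrib-+ (λ j → ⟦ j ≟ x ⟧) _) (cong₂ _+_ (sum-δ-1 x)
          (trans (∑-distrib-+ (λ j → ⟦ R? j ⟧) _)
            (cong (size R +_) (∑-distrib-+ (λ j → ⟦ Zero? (e j) ⟧) (λ j → ⟦ Zero? (ē j) ⟧)))))

      classes-≤1 : ∀ j → classes j ≤ 1
      classes-≤1 j =
        ⟦⟧-exclusive (j ≟ x)
          (⟦⟧-exclusive (R? j)
            (⟦⟧-exclusive (Zero? (e j)) (⟦⟧-≤1 (Zero? (ē j))) ≤-refl λ z → ⟦⟧-no (Zero? (ē j)) (e-ē z))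
            ≤-refl λ Rj → cong₂ _+_ (⟦⟧-no (Zero? (e j)) (R-e Rj)) (⟦⟧-no (Zero? (ē j)) (R-ē Rj)))
          ≤-refl λ { refl → cong₂ _+_ (⟦⟧-no (R? x) λ Rx → Bool.not-¬ Rx x∉R)
                            (cong₂ _+_ (⟦⟧-no (Zero? (e x)) x-e) (⟦⟧-no (Zero? (ē x)) x-ē)) }

      matched-new? : ∀ j → Dec (R j ≡ true × New p R (e j))
      matched-new? j = R? j ×-dec New? p R (e j)

      -- A new edge at an index outside `R` belongs to none of the four classes, so only new edges
      -- inside `R` can push the total above 1.
      new-classes : ∀ j → ⟦ New? p R (e j) ⟧ + classes j ≤ 1 + ⟦ matched-new? j ⟧
      new-classes j = fromDec (R? j)
        where
        fromDec : Dec (R j ≡ true) → ⟦ New? p R (e j) ⟧ + classes j ≤ 1 + ⟦ matched-new? j ⟧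
        fromDec (yes Rj) = begin
          ⟦ New? p R (e j) ⟧ + classes j ≤⟨ +-mono-≤ (⟦⟧-mono (New? p R (e j)) (matched-new? j) (Rj ,_)) (classes-≤1 j) ⟩
          ⟦ matched-new? j ⟧ + 1 ≡⟨ +-comm ⟦ matched-new? j ⟧ 1 ⟩
          1 + ⟦ matched-new? j ⟧ ∎
          where open ≤-Reasoning
        fromDec (no ¬Rj) = ⟦⟧-exclusive (New? p R (e j)) (≤-trans (classes-≤1 j) (m≤m+n 1 _)) (m≤m+n 1 _) λ new →
          cong₂ _+_ (⟦⟧-no (j ≟ x) λ { refl → x-new new })
            (cong₂ _+_ (⟦⟧-no (R? j) ¬Rj)
              (cong₂ _+_ (⟦⟧-no (Zero? (e j)) λ z → 1+n≢0 (trans (sym (proj₁ new)) z))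
                         (⟦⟧-no (Zero? (ē j)) λ z → ē-new z new)))

    degree-sum : 1 + (size R + (d + d̄)) ≤ n
    degree-sum = subst₂ _≤_ sum-classes (sum-const-1 n) (sum-mono classes-≤1)

    -- An edge that is not 0-light takes up at least one of the `m` colour incidences of the line.
    n≤m+d : n ≤ m + d
    n≤m+d = subst₂ _≤_ (sum-const-1 n)
      (trans (∑-distrib-+ (λ j → colours F (e j)) (λ j → ⟦ Zero? (e j) ⟧)) (cong (_+ d) e-total))
      (sum-mono λ j → 1≤k+zero (colours F (e j)))
      where
      1≤k+zero : ∀ k → 1 ≤ k + ⟦ k ℕ.≟ 0 ⟧
      1≤k+zero zero = ≤-refl
      1≤k+zero (suc k) = s≤s z≤n

    line : n + 1 + d̄ ≤ m + d + sum (λ j → ⟦ matched-new? j ⟧)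
    line = new-in-matched-lines n m (size R) d d̄ (sum λ j → ⟦ any? (Old? p R (e j)) ⟧)
      (sum λ j → ⟦ New? p R (e j) ⟧) (sum λ j → ⟦ matched-new? j ⟧) light-count (old-colours v e e-inj) new-count
      where
      -- A shortfall below two colours is made up: by 2 for a 0-light edge, by 1 for an edge of one
      -- colour, as this is old or new.
      light : ∀ j → 2 ≤ colours F (e j) + (2 * ⟦ Zero? (e j) ⟧ + (⟦ any? (Old? p R (e j)) ⟧ + ⟦ New? p R (e j) ⟧))
      light j = bound (colours F (e j)) (Zero? (e j)) (any? (Old? p R (e j))) (New? p R (e j)) id λ one ¬old →
        one , λ f old → ¬old (f , old)
        where
        bound : ∀ {O N : Set} k {k≡0 : Set} (z : Dec k≡0) (o : Dec O) (n : Dec N) →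
                (k ≡ 0 → k≡0) → (k ≡ 1 → ¬ O → N) → 2 ≤ k + (2 * ⟦ z ⟧ + (⟦ o ⟧ + ⟦ n ⟧))
        bound zero z o n f g rewrite ⟦⟧-yes z (f refl) = s≤s (s≤s z≤n)
        bound (suc (suc k)) z o n f g = s≤s (s≤s z≤n)
        bound (suc zero) z (yes _) n f g = s≤s (m≤n⇒m≤o+n (2 * ⟦ z ⟧) (s≤s z≤n))
        bound (suc zero) z (no ¬o) n f g rewrite ⟦⟧-yes n (g refl ¬o) = s≤s (m≤n+m 1 (2 * ⟦ z ⟧))
      light-count : n * 2 ≤ m + (2 * d + (sum (λ j → ⟦ any? (Old? p R (e j)) ⟧) + sum (λ j → ⟦ New? p R (e j) ⟧)))
      light-count = subst₂ _≤_ (sum-const n 2)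
        (trans (∑-distrib-+ (λ j → colours F (e j)) _) (cong₂ _+_ e-total
          (trans (∑-distrib-+ (λ j → 2 * ⟦ Zero? (e j) ⟧) _) (cong₂ _+_ (sum-*ˡ 2 (λ j → ⟦ Zero? (e j) ⟧))
            (∑-distrib-+ (λ j → ⟦ any? (Old? p R (e j)) ⟧) (λ j → ⟦ New? p R (e j) ⟧))))))
        (sum-mono light)
      new-count : sum (λ j → ⟦ New? p R (e j) ⟧) + (1 + (size R + (d + d̄))) ≤ n + sum (λ j → ⟦ matched-new? j ⟧)
      new-count = subst₂ _≤_
        (trans (∑-distrib-+ (λ j → ⟦ New? p R (e j) ⟧) classes) (cong (sum (λ j → ⟦ New? p R (e j) ⟧) +_) sum-classes))
        (trans (∑-distrib-+ {n} (λ _ → 1) (λ j → ⟦ matched-new? j ⟧)) (cong (_+ sum (λ j → ⟦ matched-new? j ⟧)) (sum-const-1 n)))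
        (sum-mono new-classes)

  has-colour : ∀ {e} → colours F e ≡ 1 → ∃ λ l → Has l e
  has-colour {e} one with any? (λ l → Has? l e)
  ... | yes h = h
  ... | no ¬h = ⊥-elim (1+n≢0 (trans (sym one) (trans (colours≡sum e)
          (trans (sum-cong-≗ {m} λ l → ⟦⟧-no (Has? l e) (¬h ∘ (l ,_))) (trans (sum-const m 0) (*-zeroʳ m))))))

  -- Exchanging the partners of two rows.

  swap : Fin n → Fin n → PerfectMatching n → PerfectMatching n
  swap i j π = transpose i j ∘ₚ π

  swap-matchˡ : ∀ i j π → swap i j π ⟨$⟩ʳ i ≡ π ⟨$⟩ʳ j
  swap-matchˡ i j π = cong (π ⟨$⟩ʳ_) (transpose-matchˡ i j)

  swap-matchʳ : ∀ i j π → swap i j π ⟨$⟩ʳ j ≡ π ⟨$⟩ʳ i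
  swap-matchʳ i j π = cong (π ⟨$⟩ʳ_) (transpose-matchʳ i j)

  swap-mismatch : ∀ {i j k} π → k ≢ i → k ≢ j → swap i j π ⟨$⟩ʳ k ≡ π ⟨$⟩ʳ k
  swap-mismatch π k≢i k≢j = cong (π ⟨$⟩ʳ_) (transpose-mismatch k≢i k≢j)

  ⟨$⟩ʳ-injective : (π : PerfectMatching n) → ∀ {i j} → π ⟨$⟩ʳ i ≡ π ⟨$⟩ʳ j → i ≡ j
  ⟨$⟩ʳ-injective π eq = trans (sym (inverseˡ π)) (trans (cong (π ⟨$⟩ˡ_) eq) (inverseˡ π))

  Agree-swap : ∀ {R i j} π → R i ≡ false → R j ≡ false → Agree R (π ⟨$⟩ʳ_) (swap i j π ⟨$⟩ʳ_)
  Agree-swap π Ri Rj f Rf = sym (swap-mismatch π (λ { refl → Bool.not-¬ Rf Ri }) (λ { refl → Bool.not-¬ Rf Rj }))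

  -- `a` is the gain asked for: 1 to contradict maximality, 0 to carry optimality over.
  zeros-swap : ∀ a π {i j} → i ≢ j →
    a + (⟦ Zero? (i , π ⟨$⟩ʳ i) ⟧ + ⟦ Zero? (j , π ⟨$⟩ʳ j) ⟧) ≤ ⟦ Zero? (i , π ⟨$⟩ʳ j) ⟧ + ⟦ Zero? (j , π ⟨$⟩ʳ i) ⟧ →
    a + zeros (π ⟨$⟩ʳ_) ≤ zeros (swap i j π ⟨$⟩ʳ_)
  zeros-swap a π {i} {j} i≢j le = +-cancelʳ-≤ (z i + z j) (a + sum z) (sum z′) (begin
    a + sum z + (z i + z j) ≡⟨ rearrange a (sum z) (z i + z j) ⟩
    sum z + (a + (z i + z j)) ≤⟨ +-monoʳ-≤ (sum z) le ⟩
    sum z + (⟦ Zero? (i , π ⟨$⟩ʳ j) ⟧ + ⟦ Zero? (j , π ⟨$⟩ʳ i) ⟧)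
      ≡⟨ cong (sum z +_) (cong₂ _+_ (cong (λ k → ⟦ Zero? (i , k) ⟧) (swap-matchˡ i j π))
                                    (cong (λ k → ⟦ Zero? (j , k) ⟧) (swap-matchʳ i j π))) ⟨
    sum z + (z′ i + z′ j) ≡⟨ sum-change₂ z z′ i≢j (λ k k≢i k≢j → cong (λ l → ⟦ Zero? (k , l) ⟧) (sym (swap-mismatch π k≢i k≢j))) ⟩
    sum z′ + (z i + z j) ∎)
    where
    open ≤-Reasoning
    z z′ : Fin n → ℕ
    z k = ⟦ Zero? (k , π ⟨$⟩ʳ k) ⟧
    z′ k = ⟦ Zero? (k , swap i j π ⟨$⟩ʳ k) ⟧
    rearrange : ∀ a b c → a + b + c ≡ b + (a + c)
    rearrange = solve-∀

  -- Optimal choices.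

  module Extremal (z* r* : ℕ) (zeros≤z* : ∀ π → zeros (π ⟨$⟩ʳ_) ≤ z*)
    (size≤r* : ∀ π R → Valid (π ⟨$⟩ʳ_) R → z* ≤ zeros (π ⟨$⟩ʳ_) → size R ≤ r*) where

    -- Lower bounds are enough, as the module parameters supply the matching upper bounds.
    record Top (π : PerfectMatching n) (R : Fin n → Bool) : Set where
      constructor top
      field
        valid : Valid (π ⟨$⟩ʳ_) R
        zeros-max : z* ≤ zeros (π ⟨$⟩ʳ_)
        size-max : r* ≤ size R
    open Top

    not-extendable : ∀ {π R x} → Top π R → R x ≡ false → ¬ New (π ⟨$⟩ʳ_) R (x , π ⟨$⟩ʳ x)
    not-extendable {π} {R} {x} t x∉R new = <⇒≱ (≤-trans (s≤s (size-max t)) (size-insert x∉R))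
      (size≤r* π (insert x R) (Valid-insert (valid t) new) (zeros-max t))

    no-better-swap : ∀ {π R i j} → Top π R → i ≢ j →
      ¬ (1 + (⟦ Zero? (i , π ⟨$⟩ʳ i) ⟧ + ⟦ Zero? (j , π ⟨$⟩ʳ j) ⟧) ≤ ⟦ Zero? (i , π ⟨$⟩ʳ j) ⟧ + ⟦ Zero? (j , π ⟨$⟩ʳ i) ⟧)
    no-better-swap {π} {i = i} {j} t i≢j le =
      <⇒≱ (≤-trans (s≤s (zeros-max t)) (zeros-swap 1 π i≢j le)) (zeros≤z* (swap i j π))

    Top-swap : ∀ {π R i j} → Top π R → i ≢ j → R i ≡ false → R j ≡ false →
      ⟦ Zero? (i , π ⟨$⟩ʳ i) ⟧ + ⟦ Zero? (j , π ⟨$⟩ʳ j) ⟧ ≤ ⟦ Zero? (i , π ⟨$⟩ʳ j) ⟧ + ⟦ Zero? (j , π ⟨$⟩ʳ i) ⟧ →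
      Top (swap i j π) R
    Top-swap {π} t i≢j Ri Rj le = top (Valid-agree (Agree-swap π Ri Rj) (valid t))
      (≤-trans (zeros-max t) (zeros-swap 0 π i≢j le)) (size-max t)

    -- A row outside `R` whose edge is not 0-light.

    module Unmatched {π R} (t : Top π R) {x} (x∉R : R x ≡ false) (x≢0 : colours F (x , π ⟨$⟩ʳ x) ≢ 0) where

      private
        p : Fin n → Fin n
        p = π ⟨$⟩ʳ_

        z : Fin n → Fin n → ℕ
        z i j = ⟦ Zero? (i , p j) ⟧

        zx : z x x ≡ 0
        zx = ⟦⟧-no (Zero? (x , p x)) x≢0

      R⇒≢x : ∀ {f} → R f ≡ true → f ≢ x
      R⇒≢x Rf refl = Bool.not-¬ Rf x∉R

      R⇒nonzero : ∀ {f} → R f ≡ true → z f f ≡ 0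
      R⇒nonzero {f} Rf = ⟦⟧-no (Zero? (f , p f)) λ eq → 1+n≢0 (trans (sym (proj₁ (valid t f Rf))) eq)

      -- Neither `(x , p x)` nor `(f , p f)` is 0-light, so exchanging `x` and `f` would gain a
      -- 0-light edge and lose none.
      R-row : ∀ {f} → R f ≡ true → colours F (x , p f) ≢ 0
      R-row {f} Rf eq = no-better-swap t (R⇒≢x Rf ∘ sym)
        (subst₂ (λ a b → 1 + a ≤ b + z f x) (sym (cong₂ _+_ zx (R⇒nonzero Rf))) (sym (⟦⟧-yes (Zero? (x , p f)) eq)) (m≤m+n 1 _))

      R-column : ∀ {f} → R f ≡ true → colours F (f , p x) ≢ 0
      R-column {f} Rf eq = no-better-swap t (R⇒≢x Rf ∘ sym)
        (subst₂ (λ a b → 1 + a ≤ z x f + b) (sym (cong₂ _+_ zx (R⇒nonzero Rf))) (sym (⟦⟧-yes (Zero? (f , p x)) eq)) (m≤n+m 1 _))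

      -- Otherwise exchanging `x` and `w` gains two 0-light edges and loses at most one, that of
      -- `w`.
      row-column : ∀ {w} → colours F (x , p w) ≡ 0 → colours F (w , p x) ≢ 0
      row-column {w} eq eq′ = no-better-swap t (λ { refl → x≢0 eq })
        (subst₂ (λ a b → 1 + (a + z w w) ≤ b) (sym zx)
          (sym (cong₂ _+_ (⟦⟧-yes (Zero? (x , p w)) eq) (⟦⟧-yes (Zero? (w , p x)) eq′)))
          (s≤s (⟦⟧-≤1 (Zero? (w , p w)))))

      ∉R : ∀ {w} → ¬ R w ≡ true → R w ≡ false
      ∉R {w} ¬Rw = Bool.¬-not ¬Rw

      -- The 0-light edge `(w , p x)` makes up for a possible loss of `(w , p w)`; by `R-column` the
      -- row `w` is outside `R`, so the edges at `R` stay.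
      Top-swap-column : ∀ {w} → colours F (w , p x) ≡ 0 → Top (swap x w π) R
      Top-swap-column {w} eq = Top-swap t (λ { refl → x≢0 eq }) x∉R (∉R λ Rw → R-column Rw eq)
        (subst₂ (λ a b → a + z w w ≤ z x w + b) (sym zx) (sym (⟦⟧-yes (Zero? (w , p x)) eq))
          (≤-trans (⟦⟧-≤1 (Zero? (w , p w))) (m≤n+m 1 _)))

      Top-swap-row : ∀ {w} → colours F (x , p w) ≡ 0 → Top (swap x w π) R
      Top-swap-row {w} eq = Top-swap t (λ { refl → x≢0 eq }) x∉R (∉R λ Rw → R-row Rw eq)
        (subst₂ (λ a b → a + z w w ≤ b + z w x) (sym zx) (sym (⟦⟧-yes (Zero? (x , p w)) eq))
          (≤-trans (⟦⟧-≤1 (Zero? (w , p w))) (m≤m+n 1 _)))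

      -- After the exchange `x` has the edge `(x , p w)`; were it new, `x` could join `R`.
      column-not-new : ∀ {w} → colours F (w , p x) ≡ 0 → ¬ New p R (x , p w)
      column-not-new {w} eq new = not-extendable (Top-swap-column eq) x∉R
        (New-agree (Agree-swap π x∉R (∉R λ Rw → R-column Rw eq))
          (subst (λ k → New p R (x , k)) (sym (swap-matchˡ x w π)) new))

      -- The mirror image: `w` receives `(w , p x)`, and it is `w` that could join `R`.
      row-not-new : ∀ {w} → colours F (x , p w) ≡ 0 → ¬ New p R (w , p x)
      row-not-new {w} eq new = not-extendable (Top-swap-row eq) w∉R
        (New-agree (Agree-swap π x∉R w∉R)
          (subst (λ k → New p R (w , k)) (sym (swap-matchʳ x w π)) new))
        where w∉R = ∉R λ Rw → R-row Rw eq

      Overlap? : ∀ f → Dec (R f ≡ true × New p R (x , p f) × New p R (f , p x))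
      Overlap? f = (R f Bool.≟ true) ×-dec New? p R (x , p f) ×-dec New? p R (f , p x)

      module Row = Line p R (valid t) x (λ j → x , p j) (λ j → j , p x) (colours-row x π)
        (λ h h′ → ⟨$⟩ʳ-injective π (trans (sym h) h′)) R-row R-column x∉R x≢0 x≢0
        row-column (not-extendable t x∉R) column-not-new

      module Column = Line p R (valid t) x (λ j → j , p x) (λ j → x , p j) (colours-column (p x))
        (λ {l} h h′ → ⟨$⟩ʳ-injective (F l) (trans h (sym h′))) R-column R-row x∉R x≢0 x≢0
        (λ eq eq′ → row-column eq′ eq) (not-extendable t x∉R) row-not-new

      -- Inclusion-exclusion inside `R`, applied to the counts that `line` gives for the row and for
      -- the column.
      3≤overlaps : 4 * m ≤ 3 * n → 3 ≤ sum (λ f → ⟦ Overlap? f ⟧)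
      3≤overlaps = three-overlaps n m (size R) (sum λ j → z x j) (sum λ j → z j x)
        (sum λ f → ⟦ row? f ⟧) (sum λ f → ⟦ column? f ⟧) (sum λ f → ⟦ Overlap? f ⟧)
        Row.line Column.line inclusion-exclusion Row.degree-sum Row.n≤m+d Column.n≤m+d
        where
        row? : ∀ f → Dec (R f ≡ true × New p R (x , p f))
        row? f = (R f Bool.≟ true) ×-dec New? p R (x , p f)
        column? : ∀ f → Dec (R f ≡ true × New p R (f , p x))
        column? f = (R f Bool.≟ true) ×-dec New? p R (f , p x)
        pointwise : {A B C : Set} (a : Dec A) (b : Dec B) (c : Dec C) →
                    ⟦ a ×-dec b ⟧ + ⟦ a ×-dec c ⟧ ≤ ⟦ a ⟧ + ⟦ a ×-dec b ×-dec c ⟧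
        pointwise (no _) b c = z≤n
        pointwise (yes _) (no _) c = ≤-trans (⟦⟧-≤1 (yes _ ×-dec c)) (m≤m+n 1 _)
        pointwise (yes _) (yes _) (no _) = ≤-refl
        pointwise (yes _) (yes _) (yes _) = ≤-refl
        inclusion-exclusion : sum (λ f → ⟦ row? f ⟧) + sum (λ f → ⟦ column? f ⟧) ≤ size R + sum (λ f → ⟦ Overlap? f ⟧)
        inclusion-exclusion = subst (sum (λ f → ⟦ row? f ⟧) + sum (λ f → ⟦ column? f ⟧) ≤_)
          (∑-distrib-+ (λ f → ⟦ R f Bool.≟ true ⟧) (λ f → ⟦ Overlap? f ⟧))
          (sum-+-≤ {f = λ f → ⟦ row? f ⟧} {g = λ f → ⟦ column? f ⟧} λ f → pointwise (R f Bool.≟ true) (New? p R (x , p f)) (New? p R (f , p x)))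

      -- If the colours differed, exchanging `x` and `f` would keep `R` valid, with `(f , p x)` as
      -- the edge of `f`, and leave `x` with the still new edge `(x , p f)`, so that `R` could grow.
      overlap-colour : ∀ {f l} → R f ≡ true → New p R (x , p f) → New p R (f , p x) → Has l (x , p f) → Has l (f , p x)
      overlap-colour {f} {l} Rf (one , new) (one′ , new′) h with Has? l (f , p x)
      ... | yes h′ = h′
      ... | no ¬h′ = ⊥-elim (not-extendable {swap x f π} (top valid′ (≤-trans (zeros-max t) zeros′) (size-max t)) x∉R
                       (subst (λ k → New q R (x , k)) (sym (swap-matchˡ x f π)) x-new))
        where
        q : Fin n → Fin n
        q = swap x f π ⟨$⟩ʳ_
        qf : q f ≡ p x
        qf = swap-matchʳ x f π
        same : ∀ {g} → R g ≡ true → g ≢ f → q g ≡ p g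
        same Rg g≢f = swap-mismatch π (R⇒≢x Rg) g≢f
        zeros′ : zeros p ≤ zeros q
        zeros′ = zeros-swap 0 π (R⇒≢x Rf ∘ sym) (≤-trans (≤-reflexive (cong₂ _+_ zx (R⇒nonzero Rf))) z≤n)
        valid′ : Valid q R
        valid′ g Rg with g ≟ f
        ... | yes refl = trans (cong (λ k → colours F (g , k)) qf) one′ , unique
          where
          unique : ∀ h → R h ≡ true → ∀ k → Has k (g , q g) → Has k (h , q h) → g ≡ h
          unique h Rh k hg hh with h ≟ g
          ... | yes refl = refl
          ... | no h≢g = ⊥-elim (new′ h (Rh , k , trans hg qf , trans hh (same Rh h≢g)))
        ... | no g≢f = trans (cong (λ k → colours F (g , k)) (same Rg g≢f)) (proj₁ (valid t g Rg)) , unique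
          where
          unique : ∀ h → R h ≡ true → ∀ k → Has k (g , q g) → Has k (h , q h) → g ≡ h
          unique h Rh k hg hh with h ≟ f
          ... | yes refl = ⊥-elim (new′ g (Rg , k , trans hh qf , trans hg (same Rg g≢f)))
          ... | no h≢f = proj₂ (valid t g Rg) h Rh k (trans hg (same Rg g≢f)) (trans hh (same Rh h≢f))
        x-new : New q R (x , p f)
        x-new = one , x-old
          where
          x-old : ∀ g → ¬ Old q R (x , p f) g
          x-old g (Rg , k , hx , hg) with g ≟ f
          -- Among the rows of `R` only `f` has a changed edge; a colour shared there would be `l`,
          -- lying on `(f , p x)`.
          ... | yes refl = ¬h′ (subst (λ k → Has k (g , p x)) (colour-unique one hx h) (trans hg qf))
          ... | no g≢f = new g (Rg , k , hx , trans hg (same Rg g≢f))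

    -- Exclusion of such a row by double counting.

    no-unmatched : 4 * m ≤ 3 * n → ∀ {π R} → Top π R → ∀ {x} → R x ≡ false → ¬ colours F (x , π ⟨$⟩ʳ x) ≢ 0
    no-unmatched 4m≤3n {π} {R} t {x} x∉R x≢0 =
      too-many-overlaps n m (size R) (sum λ j → ⟦ Zero? (x , p j) ⟧) (sum λ j → ⟦ Zero? (j , p x) ⟧)
        overlaps≤size U.Row.degree-sum U.Row.n≤m+d U.Column.n≤m+d 4m≤3n
      where
      module U = Unmatched t x∉R x≢0
      p : Fin n → Fin n
      p = π ⟨$⟩ʳ_
      -- An overlap `f` after the exchange of `x` and `w`, expressed through the original matching:
      -- nothing changes on `R`, and `x` gets the column `p w`. Thus `(x , p f)` is the same edge
      -- for all `w`.
      Exchange : Fin n → Fin n → Set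
      Exchange w f = colours F (w , p x) ≡ 0 × R f ≡ true × New p R (x , p f) × New p R (f , p w)
      Exchange? : ∀ w f → Dec (Exchange w f)
      Exchange? w f = Zero? (w , p x) ×-dec (R f Bool.≟ true) ×-dec New? p R (x , p f) ×-dec New? p R (f , p w)

      module Swapped {w} (eq : colours F (w , p x) ≡ 0) where
        q : Fin n → Fin n
        q = swap x w π ⟨$⟩ʳ_
        qx : q x ≡ p w
        qx = swap-matchˡ x w π
        agree : Agree R p q
        agree = Agree-swap π x∉R (U.∉R λ Rw → U.R-column Rw eq)
        agree′ : Agree R q p
        agree′ f Rf = sym (agree f Rf)
        -- By `row-column` the edge `(x , p w)` that `x` receives is again not 0-light, so the
        -- results on `x` apply to the exchanged choice.
        module V = Unmatched (U.Top-swap-column eq) x∉R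
          (λ eq′ → U.row-column (trans (cong (λ k → colours F (x , k)) (sym qx)) eq′) eq)

        overlap⇒exchange : ∀ {f} → R f ≡ true × New q R (x , q f) × New q R (f , q x) → Exchange w f
        overlap⇒exchange {f} (Rf , new , new′) = eq , Rf ,
          subst (λ k → New p R (x , k)) (agree′ f Rf) (New-agree agree′ new) ,
          subst (λ k → New p R (f , k)) qx (New-agree agree′ new′)

        3≤exchanges : 3 ≤ sum (λ f → ⟦ Exchange? w f ⟧)
        3≤exchanges = ≤-trans (V.3≤overlaps 4m≤3n) (sum-mono λ f → ⟦⟧-mono (V.Overlap? f) (Exchange? w f) overlap⇒exchange)

        exchange-colour : ∀ {f l} → Exchange w f → Has l (x , p f) → Has l (f , p w)
        exchange-colour {f} {l} (_ , Rf , new , new′) h = subst (λ k → Has l (f , k)) qx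
          (V.overlap-colour Rf (subst (λ k → New q R (x , k)) (agree f Rf) (New-agree agree new))
            (subst (λ k → New q R (f , k)) (sym qx) (New-agree agree new′)) (trans h (agree f Rf)))

      -- Pairs `w`, `f` are counted in two ways: each `w` with `(w , p x)` 0-light has at least
      -- three `f`, each `f` in `R` at most one `w`.
      overlaps≤size : 3 * sum (λ w → ⟦ Zero? (w , p x) ⟧) ≤ size R
      overlaps≤size = begin
        3 * sum (λ w → ⟦ Zero? (w , p x) ⟧) ≡⟨ sum-*ˡ 3 (λ w → ⟦ Zero? (w , p x) ⟧) ⟨
        sum (λ w → 3 * ⟦ Zero? (w , p x) ⟧) ≤⟨ sum-mono (λ w → three w (Zero? (w , p x))) ⟩
        sum (λ w → sum λ f → ⟦ Exchange? w f ⟧) ≡⟨ ∑-comm (λ w f → ⟦ Exchange? w f ⟧) ⟩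
        sum (λ f → sum λ w → ⟦ Exchange? w f ⟧) ≤⟨ sum-mono (λ f → one f (R f Bool.≟ true)) ⟩
        size R ∎
        where
        open ≤-Reasoning
        three : ∀ w → (d : Dec (colours F (w , p x) ≡ 0)) → 3 * ⟦ d ⟧ ≤ sum (λ f → ⟦ Exchange? w f ⟧)
        three w (no _) = z≤n
        three w (yes eq) = Swapped.3≤exchanges eq
        one : ∀ f → (d : Dec (R f ≡ true)) → sum (λ w → ⟦ Exchange? w f ⟧) ≤ ⟦ d ⟧
        one f (no ¬Rf) = ≤-reflexive (trans (sum-cong-≗ {n} λ w → ⟦⟧-no (Exchange? w f) (¬Rf ∘ proj₁ ∘ proj₂))
                                            (trans (sum-const n 0) (*-zeroʳ n)))
        -- The colour `l` of `(x , p f)` lies on `(f , p w)` and on `(f , p w′)`, but `F l` has only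
        -- one edge at `f`.
        one f (yes _) = sum-≤1 (λ w → Exchange? w f) λ w w′ ex ex′ →
          let (l , h) = has-colour (proj₁ (proj₁ (proj₂ (proj₂ ex))))
          in ⟨$⟩ʳ-injective π (trans (sym (Swapped.exchange-colour (proj₁ ex) ex h)) (Swapped.exchange-colour (proj₁ ex′) ex′ h))

  -- Deciding which counts are attained.

  zeros≤n : ∀ p → zeros p ≤ n
  zeros≤n p = subst (zeros p ≤_) (sum-const-1 n) (sum-mono λ i → ⟦⟧-≤1 (Zero? (i , p i)))

  size≤n : ∀ R → size R ≤ n
  size≤n R = subst (size R ≤_) (sum-const-1 n) (sum-mono λ i → ⟦⟧-≤1 (R i Bool.≟ true))

  -- For `k = 0` the empty `R` qualifies, so `State z 0` says only that some perfect matching has at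
  -- least `z` 0-light edges.
  State : ℕ → ℕ → Set
  State z k = ∃ λ π → ∃ λ R → Valid (π ⟨$⟩ʳ_) R × z ≤ zeros (π ⟨$⟩ʳ_) × k ≤ size R

  State? : ∀ z k → Dec (State z k)
  State? z k = map′ to from (search-→ (search-× search-Fin (search-× search-Fin search-Bool)) Q Q-resp Q?)
    where
    -- A permutation is searched for together with its inverse.
    Code : Set
    Code = Fin n → Fin n × Fin n × Bool
    f g : Code → Fin n → Fin n
    f s i = proj₁ (s i)
    g s i = proj₁ (proj₂ (s i))
    R : Code → Fin n → Bool
    R s i = proj₂ (proj₂ (s i))
    Q : Code → Set
    Q s = (∀ i → f s (g s i) ≡ i) × (∀ i → g s (f s i) ≡ i) × Valid (f s) (R s) × z ≤ zeros (f s) × k ≤ size (R s)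
    Q? : ∀ s → Dec (Q s)
    Q? s = all? (λ i → f s (g s i) ≟ i) ×-dec all? (λ i → g s (f s i) ≟ i) ×-dec Valid? (f s) (R s)
      ×-dec (z ≤? zeros (f s)) ×-dec (k ≤? size (R s))
    Q-resp : ∀ {s s′} → s ≗ s′ → Q s → Q s′
    Q-resp {s} {s′} eq (fg , gf , v , z≤ , k≤) =
      (λ i → trans (cong (f s′) (sym (g-eq i))) (trans (sym (f-eq _)) (fg i))) ,
      (λ i → trans (cong (g s′) (sym (f-eq i))) (trans (sym (g-eq _)) (gf i))) ,
      Valid-agree {R s′} (λ i _ → f-eq i)
        (λ i Ri → let (one , unique) = v i (trans (R-eq i) Ri) in one , λ j Rj → unique j (trans (R-eq j) Rj)) ,
      subst (z ≤_) (sum-cong-≗ {n} λ i → cong (λ j → ⟦ Zero? (i , j) ⟧) (f-eq i)) z≤ ,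
      subst (k ≤_) (sum-cong-≗ {n} λ i → cong (λ b → ⟦ b Bool.≟ true ⟧) (R-eq i)) k≤
      where
      f-eq : ∀ i → f s i ≡ f s′ i
      f-eq i = cong proj₁ (eq i)
      g-eq : ∀ i → g s i ≡ g s′ i
      g-eq i = cong (proj₁ ∘ proj₂) (eq i)
      R-eq : ∀ i → R s i ≡ R s′ i
      R-eq i = cong (proj₂ ∘ proj₂) (eq i)
    to : ∃ Q → State z k
    to (s , fg , gf , rest) = permutation (f s) (g s) fg gf , R s , rest
    from : State z k → ∃ Q
    from (π , R , rest) = (λ i → π ⟨$⟩ʳ i , π ⟨$⟩ˡ i , R i) , (λ i → inverseʳ π) , (λ i → inverseˡ π) , rest

  -- 0-light matchings as lists of edges.

  -- Induction on `M`: to add `(i , j)`, exchange `i` with the row now matched to `j`. The other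
  -- edges of `M` avoid both rows and stay in place.
  extend-matching : ∀ M → IsMatching M → ∃ λ (π : PerfectMatching n) → ∀ {e} → e ∈ M → e ∈PM π
  extend-matching [] _ = idₚ , λ ()
  extend-matching ((i , j) ∷ M) (e∉M ∷ uniq , disjoint)
    with extend-matching M (uniq , λ p q → disjoint (there p) (there q))
  ... | π , M⊆π = swap i (π ⟨$⟩ˡ j) π , contains
    where
    contains : ∀ {e} → e ∈ (i , j) ∷ M → e ∈PM swap i (π ⟨$⟩ˡ j) π
    contains (here refl) = trans (swap-matchˡ i _ π) (inverseʳ π)
    contains {i′ , j′} (there e∈M) = trans (swap-mismatch π i′≢i i′≢πj) (M⊆π e∈M)
      where
      i′≢i : i′ ≢ i
      i′≢i eq = All.lookup e∉M e∈M (disjoint (here refl) (there e∈M) (inj₁ (sym eq)))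
      i′≢πj : i′ ≢ π ⟨$⟩ˡ j
      i′≢πj eq = All.lookup e∉M e∈M (disjoint (here refl) (there e∈M)
        (inj₂ (trans (sym (inverseʳ π)) (trans (cong (π ⟨$⟩ʳ_) (sym eq)) (M⊆π e∈M)))))

  zero-edges : PerfectMatching n → List (Edge n)
  zero-edges π = map (λ i → i , π ⟨$⟩ʳ i) (filter (λ i → Zero? (i , π ⟨$⟩ʳ i)) (allFin n))

  zero-edges⊆ : ∀ π {e} → e ∈ zero-edges π → e ∈PM π × colours F e ≡ 0
  zero-edges⊆ π e∈ with ∈-map⁻ _ e∈
  ... | i , i∈ , refl = refl , proj₂ (∈-filter⁻ (λ i → Zero? (i , π ⟨$⟩ʳ i)) {xs = allFin n} i∈)

  length-zero-edges : ∀ π → length (zero-edges π) ≡ zeros (π ⟨$⟩ʳ_)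
  length-zero-edges π = trans (length-map (λ i → i , π ⟨$⟩ʳ i) (filter (λ i → Zero? (i , π ⟨$⟩ʳ i)) (allFin n)))
    (length-filter-tabulate (λ i → Zero? (i , π ⟨$⟩ʳ i)) id)

  zero-edges-matching : ∀ π → IsMatching (zero-edges π)
  zero-edges-matching π = map⁺ (cong proj₁) (filter⁺ _ (allFin⁺ n)) , disjoint
    where
    disjoint : ∀ {e f} → e ∈ zero-edges π → f ∈ zero-edges π → proj₁ e ≡ proj₁ f ⊎ proj₂ e ≡ proj₂ f → e ≡ f
    disjoint e∈ f∈ eq with proj₁ (zero-edges⊆ π e∈) | proj₁ (zero-edges⊆ π f∈) | eq
    ... | refl | refl | inj₁ refl = refl
    ... | refl | refl | inj₂ eq′ with ⟨$⟩ʳ-injective π eq′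
    ...   | refl = refl

  -- Extend `M` to a perfect matching; the edges of `M` are then among its 0-light edges, in
  -- distinct rows.
  0-light≤zeros : ∀ {z} → (∀ π → zeros (π ⟨$⟩ʳ_) ≤ z) → ∀ M → IsMatching M → KLight 0 F M → length M ≤ z
  0-light≤zeros zeros≤z M (uniq , disjoint) light = ≤-trans
    (length≤sum proj₁ (λ i → Zero? (i , π ⟨$⟩ʳ i)) M uniq (λ p q eq → disjoint p q (inj₁ eq))
      (λ { {i , j} e∈M → trans (cong (λ k → colours F (i , k)) (M⊆π e∈M)) (n≤0⇒n≡0 (light e∈M)) }))
    (zeros≤z π)
    where
    π : PerfectMatching n
    π = proj₁ (extend-matching M (uniq , disjoint))
    M⊆π : ∀ {e} → e ∈ M → e ∈PM π
    M⊆π = proj₂ (extend-matching M (uniq , disjoint))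

  -- The optimal choice and the conclusion.

  -- A lexicographic maximum: first the number of 0-light edges, then the size of `R` among the
  -- choices attaining it. Both are at most `n`.
  maximal-state : ∃ λ z → (∀ π → zeros (π ⟨$⟩ʳ_) ≤ z) × (∃ λ k → State z k × (∀ {l} → State z l → l ≤ k))
  maximal-state = z , (λ π → max (π , (λ _ → false) , (λ _ ()) , ≤-refl , z≤n)) ,
    maximum (State z) (State? z) state n (λ { (_ , R , _ , _ , k≤) → ≤-trans k≤ (size≤n R) })
    where
    most-zeros : ∃ λ z → State z 0 × (∀ {l} → State l 0 → l ≤ z)
    most-zeros = maximum (λ z → State z 0) (λ z → State? z 0) (idₚ , (λ _ → false) , (λ _ ()) , z≤n , z≤n) n
      (λ { (π , _ , _ , z≤ , _) → ≤-trans z≤ (zeros≤n (π ⟨$⟩ʳ_)) })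
    z : ℕ
    z = proj₁ most-zeros
    state : State z 0
    state = proj₁ (proj₂ most-zeros)
    max : ∀ {l} → State l 0 → l ≤ z
    max = proj₂ (proj₂ most-zeros)

mainTheorem3 : (n m : ℕ) → 1 ≤ n → 4 * m ≤ 3 * n →
    (F : Family m n) → Distinct F →
    Σ (PerfectMatching n) λ π → KLightPM 1 F π × KRainbowPM 1 F π ×
    Σ (List (Edge n)) λ M → IsMax0Light F M × (∀ {e} → e ∈ M → e ∈PM π)
mainTheorem3 n m _ 4m≤3n F _ with maximal-state F
... | z* , zeros≤z* , r* , (π , R , valid , z*≤ , r*≤) , max =
  π , light , rainbow , zero-edges F π ,
  (zero-edges-matching F π , (λ e∈ → ≤-reflexive (proj₂ (zero-edges⊆ F π e∈))) , maximum-light) ,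
  λ e∈ → proj₁ (zero-edges⊆ F π e∈)
  where
  open Extremal F z* r* zeros≤z* (λ π R v z≤ → max (π , R , v , z≤ , ≤-refl))
  -- Every edge of `π` is thus 0-light or at a row of `R`, and `valid` then yields both the light
  -- and the rainbow property.
  nonzero⇒R : ∀ i → colours F (i , π ⟨$⟩ʳ i) ≢ 0 → R i ≡ true
  nonzero⇒R i nz = Bool.¬-not λ Ri → no-unmatched 4m≤3n {π} (top valid z*≤ r*≤) Ri nz
  light : KLightPM 1 F π
  light i with Zero? F (i , π ⟨$⟩ʳ i)
  ... | yes eq = subst (_≤ 1) (sym eq) z≤n
  ... | no nz = ≤-reflexive (proj₁ (valid i (nonzero⇒R i nz)))
  has⇒R : ∀ {l} i → Has F l (i , π ⟨$⟩ʳ i) → R i ≡ true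
  has⇒R i h = nonzero⇒R i λ eq → <⇒≱ (has⇒colours>0 F {e = i , π ⟨$⟩ʳ i} h) (≤-reflexive eq)
  rainbow : KRainbowPM 1 F π
  rainbow l = subst (_≤ 1) (sym (count≡sum λ i → F l ⟨$⟩ʳ i ≟ π ⟨$⟩ʳ i))
    (sum-≤1 (λ i → F l ⟨$⟩ʳ i ≟ π ⟨$⟩ʳ i) λ i j hi hj →
      proj₂ (valid i (has⇒R i hi)) j (has⇒R j hj) l hi hj)
  maximum-light : ∀ M′ → IsMatching M′ → KLight 0 F M′ → length M′ ≤ length (zero-edges F π)
  -- The number `z*` bounds every 0-light matching, and `π` has at least that many 0-light edges.
  maximum-light M′ matching light₀ = subst (length M′ ≤_) (sym (length-zero-edges F π))
    (≤-trans (0-light≤zeros F zeros≤z* M′ matching light₀) z*≤)
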